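{- For all integers $n>p\ge 0$, $$\sum_{k=p+1}^{n}\binom{n}{k}{k\brace p+1}B_{n-k,p}=\frac{p^{\,n-1}\,(n-pH_{p})}{p!}+\sum_{j=1}^{p}{n\brace p-j}\frac{H_{j}}{j!}.$$
   Context: The $p$-Bernoulli numbers $B_{n,p}$ ($n\ge 0$, $p\ge 0$ integers) are the rational numbers determined by $B_{0,p}=1$ for all $p\ge 0$ and the recursion $$B_{n+1,p}=p\,B_{n,p}-\frac{(p+1)^{2}}{p+2}\,B_{n,p+1}.$$ Equivalently, $B_{n,p}=\sum_{k=0}^{n}(-1)^{k}{n\brace k}\binom{k+p+1}{k}^{ -1}k!$. In particular $B_{n,0}=B_n$ is the $n$th Bernoulli number. ${n\brace k}$ denotes the Stirling number of the second kind, i.e. $\sum_{n\ge 0}{n\brace k}\frac{t^n}{n!}=\frac{(e^t-1)^k}{k!}$. $H_n=\sum_{j=1}^{n}\frac1j$ is the $n$th harmonic number, with $H_0=0$; empty sums are $0$. The convention $0^0=1$ is used (relevant for $p=0$, $n=1$). -}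

module Defs where

open import Algebra.Properties.Monoid.Sum using (sum)
open import Data.Fin.Base using (toℕ)
open import Data.Integer.Base using (+_)
open import Data.Nat.Base as ℕ using (ℕ; zero; suc; _∸_; _!; _^_)
open import Data.Nat.Properties using (_!≢0)
open import Data.Rational.Base using (ℚ; 0ℚ; 1ℚ; _+_; _-_; _*_; _/_)
open import Data.Rational.Properties using (+-0-monoid)

infixr 6.5 sumFromTo
infixl 7 _/!_ _⊛_
infixr 8 _^ₛ_

fromℕ : ℕ → ℚ
fromℕ n = + n / 1

_/!_ : ℚ → ℕ → ℚ
q /! n = q * ((+ 1 / n !) {{n !≢0}})

-- Both bounds are inclusive; the sum is empty when b < a.  In the notation
-- the body extends over products but not over _+_.
sumFromTo : ℕ → ℕ → (ℕ → ℚ) → ℚ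
sumFromTo a b f = sum +-0-monoid {suc b ∸ a} (λ i → f (a ℕ.+ toℕ i))

syntax sumFromTo a b (λ k → x) = ∑[ k ∈ a ⋯ b ] x

-- Formal power series in t over ℚ, as the sequence of coefficients of tⁿ.
Series : Set
Series = ℕ → ℚ

1ₛ : Series
1ₛ zero    = 1ℚ
1ₛ (suc _) = 0ℚ

_⊛_ : Series → Series → Series
(f ⊛ g) n = ∑[ i ∈ 0 ⋯ n ] f i * g (n ∸ i)

_^ₛ_ : Series → ℕ → Series
f ^ₛ zero  = 1ₛ
f ^ₛ suc k = f ⊛ (f ^ₛ k)

exp : Series
exp n = 1ℚ /! n

exp-1 : Series
exp-1 n = exp n - 1ₛ n

-- Stirling numbers of the second kind (as rationals), read off from
-- ∑ₙ (stirling₂ n k) tⁿ / n! = (eᵗ - 1)ᵏ / k!.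
stirling₂ : ℕ → ℕ → ℚ
stirling₂ n k = fromℕ (n !) * ((exp-1 ^ₛ k) n /! k)

H : ℕ → ℚ
H n = sum +-0-monoid {n} (λ i → + 1 / suc (toℕ i))

-- p-Bernoulli numbers: B n p is B_{n,p}.
B : ℕ → ℕ → ℚ
B zero    p = 1ℚ
B (suc n) p = fromℕ p * B n p - (+ (suc p ^ 2) / suc (suc p)) * B n (suc p)

{-# OPTIONS --safe #-}
-- With E = eᵗ − 1 and F_p = ∑ₙ B_{n,p} tⁿ / n!, the left-hand side is the
-- coefficient of tⁿ / n! in G_p = Eᵖ⁺¹ F_p / (p+1)!.  The recursion of the B_{n,p}
-- becomes E G_p′ = (p+1) G_p + (2p+1) E G_p − (p+1)² G_{p+1}, and this determines
-- G_p from G_p = tᵖ⁺¹ / (p+1)! + O(tᵖ⁺²).  The solutions R_p of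
-- R_p′ = p R_p + Eᵖ / p!, R_p(0) = 0, satisfy the same relations, since
-- (p+1) R_{p+1} = eᵗ R_p − Eᵖ⁺¹ / (p+1)!.  The right-hand side solves the same
-- differential equation, because eᵖᵗ / p! = ∑ⱼ Eᵖ⁻ʲ / ((p−j)! j!).
module Submission where

open import Defs
open import Algebra.Properties.CommutativeMonoid.Sum using (∑-distrib-+)
open import Algebra.Properties.Monoid.Sum using (sum; sum-cong-≗; sum-init-last)
open import Algebra.Bundles using (CommutativeRing)
open import Algebra.Properties.Semiring.Sum using (*-distribˡ-sum)
open import Data.Fin.Base using (toℕ)
open import Data.Fin.Properties using (toℕ<n; toℕ-inject₁; toℕ-fromℕ)
open import Data.Integer.Base using () renaming (+_ to pos)
import Data.Integer.Base as ℤ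
import Data.Integer.Properties as ℤ
open import Data.Nat.Base using (ℕ; zero; suc; _<_; _≤_; _∸_; _^_; _!; NonZero; z<s; s<s; s≤s⁻¹)
import Data.Nat.Base as ℕ
open import Data.Nat.Combinatorics using (_C_; nCk+nC[k+1]≡[n+1]C[k+1]; k>n⇒nCk≡0)
import Data.Nat.Properties as ℕ
open import Data.Nat.Properties using (_!≢0)
open import Data.Rational.Base using (ℚ; 0ℚ; 1ℚ; _+_; _-_; -_; _*_; _/_; toℚᵘ)
open import Data.Rational.Properties
import Data.Rational.Unnormalised.Base as ℚᵘ
import Data.Rational.Unnormalised.Properties as ℚᵘ
open import Data.Sum.Base using (inj₁; inj₂)
open import Function.Base using (_∘_)
open import Level using (0ℓ)
open import Relation.Binary.PropositionalEquality
open import Relation.Nullary.Decidable.Core using (dec⇒maybe)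
open import Tactic.RingSolver using (solve-∀)
open import Tactic.RingSolver.Core.AlmostCommutativeRing using (AlmostCommutativeRing; fromCommutativeRing)

-- The recursion for F_p involves F_{p+1}, so no single G_p can be solved for; the identification
-- has to treat the whole family at once. Differentiating Eᵖ⁺¹ / (p+1)! leaves a stray Eᵖ F_p / p!,
-- and this is why the relation is multiplied by E once more: the stray term becomes (p+1) G_p, and
-- the p+2 gained in the F_{p+1} term cancels the denominator of (p+1)²/(p+2). The resulting
-- relation is singular at t = 0, so uniqueness is an argument about orders of vanishing. For a
-- difference X_p of two solutions, all orders are raised together: at the first undecided index the
-- term E X_p is one order too high to contribute, and X_{p+1} starts one place later than X_p. What
-- remains compares two different multiples of one coefficient. Making the Leibniz rule the
-- definition of the product turns d/dt into an index shift and the ring laws into inductions on the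
-- index, without double sums. Cauchy products and binomial sums are translated only in `toEGF-⊛`
-- and `∑-binomial-∗`.

ℚ-ring : AlmostCommutativeRing 0ℓ 0ℓ
ℚ-ring = fromCommutativeRing +-*-commutativeRing (λ x → dec⇒maybe (0ℚ ≟ x))

-- Naturals, fractions and reciprocal factorials in the rationals.

toℚᵘ-/ : ∀ a d .{{_ : NonZero d}} → toℚᵘ (pos a / d) ℚᵘ.≃ (pos a ℚᵘ./ d)
toℚᵘ-/ a (suc d) = toℚᵘ-fromℚᵘ (ℚᵘ.mkℚᵘ (pos a) d)

-- `_/_` reduces by a gcd that is stuck on variables, so the check takes place in the unnormalised
-- rationals, by cross multiplication. All later cancellation of denominators rests on this
-- identity.
/-*-fromℕ : ∀ a d .{{_ : NonZero d}} → (pos a / d) * fromℕ d ≡ fromℕ a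
/-*-fromℕ a d@(suc _) = toℚᵘ-injective (begin
  toℚᵘ ((pos a / d) * fromℕ d)           ≈⟨ toℚᵘ-homo-* (pos a / d) (fromℕ d) ⟩
  toℚᵘ (pos a / d) ℚᵘ.* toℚᵘ (fromℕ d)   ≈⟨ ℚᵘ.*-cong (toℚᵘ-/ a d) (toℚᵘ-/ d 1) ⟩
  (pos a ℚᵘ./ d) ℚᵘ.* (pos d ℚᵘ./ 1)       ≈⟨ ℚᵘ.*≡* (ℤ.*-assoc (pos a) (pos d) (pos 1)) ⟩
  (pos a ℚᵘ./ 1)                         ≈⟨ toℚᵘ-/ a 1 ⟨
  toℚᵘ (fromℕ a) ∎)
  where open import Relation.Binary.Reasoning.Setoid ℚᵘ.≃-setoid

fromℕ-+ : ∀ m n → fromℕ (m ℕ.+ n) ≡ fromℕ m + fromℕ n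
fromℕ-+ m n = toℚᵘ-injective (begin
  toℚᵘ (fromℕ (m ℕ.+ n))                  ≈⟨ toℚᵘ-/ (m ℕ.+ n) 1 ⟩
  (pos (m ℕ.+ n) ℚᵘ./ 1)                    ≈⟨ ℚᵘ.*≡* (cong (ℤ._* pos 1) (sym (cong₂ ℤ._+_ (ℤ.*-identityʳ (pos m)) (ℤ.*-identityʳ (pos n))))) ⟩
  (pos m ℚᵘ./ 1) ℚᵘ.+ (pos n ℚᵘ./ 1)          ≈⟨ ℚᵘ.+-cong (toℚᵘ-/ m 1) (toℚᵘ-/ n 1) ⟨
  toℚᵘ (fromℕ m) ℚᵘ.+ toℚᵘ (fromℕ n)      ≈⟨ toℚᵘ-homo-+ (fromℕ m) (fromℕ n) ⟨
  toℚᵘ (fromℕ m + fromℕ n) ∎)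
  where open import Relation.Binary.Reasoning.Setoid ℚᵘ.≃-setoid

fromℕ-* : ∀ m n → fromℕ (m ℕ.* n) ≡ fromℕ m * fromℕ n
fromℕ-* m n = toℚᵘ-injective (begin
  toℚᵘ (fromℕ (m ℕ.* n))                  ≈⟨ toℚᵘ-/ (m ℕ.* n) 1 ⟩
  (pos (m ℕ.* n) ℚᵘ./ 1)                    ≈⟨ ℚᵘ.*≡* (cong (ℤ._* pos 1) (ℤ.pos-* m n)) ⟩
  (pos m ℚᵘ./ 1) ℚᵘ.* (pos n ℚᵘ./ 1)          ≈⟨ ℚᵘ.*-cong (toℚᵘ-/ m 1) (toℚᵘ-/ n 1) ⟨
  toℚᵘ (fromℕ m) ℚᵘ.* toℚᵘ (fromℕ n)      ≈⟨ toℚᵘ-homo-* (fromℕ m) (fromℕ n) ⟨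
  toℚᵘ (fromℕ m * fromℕ n) ∎)
  where open import Relation.Binary.Reasoning.Setoid ℚᵘ.≃-setoid

open ≡-Reasoning

fromℕ-suc : ∀ n → fromℕ (suc n) ≡ 1ℚ + fromℕ n
fromℕ-suc = fromℕ-+ 1

fromℕ-suc-cancel : ∀ k {x y} → fromℕ (suc k) * x ≡ fromℕ (suc k) * y → x ≡ y
fromℕ-suc-cancel k {x} {y} eq = begin
  x                          ≡⟨ unit x ⟩
  r * (fromℕ (suc k) * x)    ≡⟨ cong (r *_) eq ⟩
  r * (fromℕ (suc k) * y)    ≡⟨ unit y ⟨
  y                          ∎
  where
  r = pos 1 / suc k
  unit : ∀ z → z ≡ r * (fromℕ (suc k) * z)
  unit z = begin
    z                        ≡⟨ *-identityˡ z ⟨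
    1ℚ * z                   ≡⟨ cong (_* z) (/-*-fromℕ 1 (suc k)) ⟨
    r * fromℕ (suc k) * z    ≡⟨ *-assoc r _ z ⟩
    r * (fromℕ (suc k) * z)  ∎

1/! : ℕ → ℚ
1/! n = (pos 1 / n !) {{n !≢0}}

1/!-! : ∀ n → 1/! n * fromℕ (n !) ≡ 1ℚ
1/!-! n = /-*-fromℕ 1 (n !) {{n !≢0}}

1/!-suc : ∀ n → fromℕ (suc n) * 1/! (suc n) ≡ 1/! n
1/!-suc n = begin
  s * i                        ≡⟨ *-identityʳ (s * i) ⟨
  s * i * 1ℚ                   ≡⟨ cong (s * i *_) (1/!-! n) ⟨
  s * i * (1/! n * f)          ≡⟨ rearrange s i (1/! n) f ⟩
  i * (s * f) * 1/! n          ≡⟨ cong (λ x → i * x * 1/! n) (fromℕ-* (suc n) (n !)) ⟨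
  i * fromℕ (suc n !) * 1/! n  ≡⟨ cong (_* 1/! n) (1/!-! (suc n)) ⟩
  1ℚ * 1/! n                   ≡⟨ *-identityˡ (1/! n) ⟩
  1/! n                        ∎
  where
  s = fromℕ (suc n)
  i = 1/! (suc n)
  f = fromℕ (n !)
  rearrange : ∀ s i j f → s * i * (j * f) ≡ i * (s * f) * j
  rearrange = solve-∀ ℚ-ring

-- Finite sums over initial segments, the form to which `sumFromTo` unfolds.

∑< : ℕ → (ℕ → ℚ) → ℚ
∑< n f = sum +-0-monoid {n} (f ∘ toℕ)

∑<-cong : ∀ n {f g : ℕ → ℚ} → (∀ i → i < n → f i ≡ g i) → ∑< n f ≡ ∑< n g
∑<-cong n eq = sum-cong-≗ +-0-monoid (λ i → eq (toℕ i) (toℕ<n i))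

∑<-last : ∀ n f → ∑< (suc n) f ≡ ∑< n f + f n
∑<-last n f = trans (sum-init-last +-0-monoid {n} (f ∘ toℕ))
  (cong₂ _+_ (sum-cong-≗ +-0-monoid {n} (cong f ∘ toℕ-inject₁)) (cong f (toℕ-fromℕ n)))

∑<-+ : ∀ n f g → ∑< n (λ i → f i + g i) ≡ ∑< n f + ∑< n g
∑<-+ n f g = ∑-distrib-+ +-0-commutativeMonoid {n} (f ∘ toℕ) (g ∘ toℕ)

∑<-* : ∀ n x f → ∑< n (λ i → x * f i) ≡ x * ∑< n f
∑<-* n x f = sym (*-distribˡ-sum (CommutativeRing.semiring +-*-commutativeRing) {n} x (f ∘ toℕ))

∑<-zero : ∀ n {f} → (∀ i → i < n → f i ≡ 0ℚ) → ∑< n f ≡ 0ℚ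
∑<-zero n {f} eq = begin
  ∑< n f                ≡⟨ ∑<-cong n (λ i i<n → trans (eq i i<n) (sym (*-zeroˡ 0ℚ))) ⟩
  ∑< n (λ _ → 0ℚ * 0ℚ)  ≡⟨ ∑<-* n 0ℚ (λ _ → 0ℚ) ⟩
  0ℚ * ∑< n (λ _ → 0ℚ)  ≡⟨ *-zeroˡ (∑< n (λ _ → 0ℚ)) ⟩
  0ℚ                    ∎

∑<-split : ∀ m l f → ∑< (m ℕ.+ l) f ≡ ∑< m f + ∑< l (λ i → f (m ℕ.+ i))
∑<-split zero    l f = sym (+-identityˡ _)
∑<-split (suc m) l f = trans (cong (f 0 +_) (∑<-split m l (f ∘ suc))) (sym (+-assoc (f 0) _ _))

∸-suc : ∀ {i n} → i < suc n → suc n ∸ i ≡ suc (n ∸ i)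
∸-suc i<1+n = ℕ.+-∸-assoc 1 (s≤s⁻¹ i<1+n)

fromℕ-∸ : ∀ {i n} → i ≤ n → fromℕ (n ∸ i) ≡ fromℕ n - fromℕ i
fromℕ-∸ {i} {n} i≤n = begin
  fromℕ (n ∸ i)                       ≡⟨ add-sub (fromℕ (n ∸ i)) (fromℕ i) ⟩
  fromℕ (n ∸ i) + fromℕ i - fromℕ i   ≡⟨ cong (_- fromℕ i) (fromℕ-+ (n ∸ i) i) ⟨
  fromℕ (n ∸ i ℕ.+ i) - fromℕ i       ≡⟨ cong (λ m → fromℕ m - fromℕ i) (ℕ.m∸n+n≡m i≤n) ⟩
  fromℕ n - fromℕ i                   ∎
  where
  add-sub : ∀ x y → x ≡ x + y - y
  add-sub = solve-∀ ℚ-ring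

-- Algebra of exponential generating functions.

-- Below, a sequence a stands for ∑ₙ aₙ tⁿ / n!; then ∂ is d/dt and _∗_ is the
-- product, defined by the Leibniz rule.

infixl 6 _⊕_
infixr 7 _·_
infixl 7 _∗_

_⊕_ : Series → Series → Series
(a ⊕ b) n = a n + b n

_·_ : ℚ → Series → Series
(x · a) n = x * a n

∂ : Series → Series
∂ a n = a (suc n)

_∗_ : Series → Series → Series
(a ∗ b) zero    = a 0 * b 0
(a ∗ b) (suc n) = (∂ a ∗ b) n + (a ∗ ∂ b) n

∗-cong : ∀ {a b c d} → a ≗ b → c ≗ d → a ∗ c ≗ b ∗ d
∗-cong p q zero    = cong₂ _*_ (p 0) (q 0)
∗-cong p q (suc n) = cong₂ _+_ (∗-cong (p ∘ suc) q n) (∗-cong p (q ∘ suc) n)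

∗-congˡ : ∀ {a c d} → c ≗ d → a ∗ c ≗ a ∗ d
∗-congˡ = ∗-cong (λ _ → refl)

∗-congʳ : ∀ {a b c} → a ≗ b → a ∗ c ≗ b ∗ c
∗-congʳ p = ∗-cong p (λ _ → refl)

∗-comm : ∀ a b → a ∗ b ≗ b ∗ a
∗-comm a b zero    = *-comm (a 0) (b 0)
∗-comm a b (suc n) = trans (cong₂ _+_ (∗-comm (∂ a) b n) (∗-comm a (∂ b) n))
                          (+-comm ((b ∗ ∂ a) n) ((∂ b ∗ a) n))

interchange : ∀ w x y z → (w + x) + (y + z) ≡ (w + y) + (x + z)
interchange = solve-∀ ℚ-ring

∗-distribʳ-⊕ : ∀ a b c → (a ⊕ b) ∗ c ≗ a ∗ c ⊕ b ∗ c
∗-distribʳ-⊕ a b c zero    = *-distribʳ-+ (c 0) (a 0) (b 0)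
∗-distribʳ-⊕ a b c (suc n) =
  trans (cong₂ _+_ (∗-distribʳ-⊕ (∂ a) (∂ b) c n) (∗-distribʳ-⊕ a b (∂ c) n))
        (interchange ((∂ a ∗ c) n) ((∂ b ∗ c) n) ((a ∗ ∂ c) n) ((b ∗ ∂ c) n))

∗-distribˡ-⊕ : ∀ a b c → a ∗ (b ⊕ c) ≗ a ∗ b ⊕ a ∗ c
∗-distribˡ-⊕ a b c n = begin
  (a ∗ (b ⊕ c)) n         ≡⟨ ∗-comm a (b ⊕ c) n ⟩
  ((b ⊕ c) ∗ a) n         ≡⟨ ∗-distribʳ-⊕ b c a n ⟩
  (b ∗ a) n + (c ∗ a) n   ≡⟨ cong₂ _+_ (∗-comm b a n) (∗-comm c a n) ⟩
  (a ∗ b) n + (a ∗ c) n   ∎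

·-∗ : ∀ x a b → (x · a) ∗ b ≗ x · (a ∗ b)
·-∗ x a b zero    = *-assoc x (a 0) (b 0)
·-∗ x a b (suc n) = trans (cong₂ _+_ (·-∗ x (∂ a) b n) (·-∗ x a (∂ b) n))
                          (sym (*-distribˡ-+ x _ _))

∗-· : ∀ x a b → a ∗ (x · b) ≗ x · (a ∗ b)
∗-· x a b n = trans (∗-comm a (x · b) n) (trans (·-∗ x b a n) (cong (x *_) (∗-comm b a n)))

∗-assoc : ∀ a b c → (a ∗ b) ∗ c ≗ a ∗ (b ∗ c)
∗-assoc a b c zero    = *-assoc (a 0) (b 0) (c 0)
∗-assoc a b c (suc n) = begin
  ((∂ a ∗ b ⊕ a ∗ ∂ b) ∗ c) n + ((a ∗ b) ∗ ∂ c) n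
    ≡⟨ cong (_+ ((a ∗ b) ∗ ∂ c) n) (∗-distribʳ-⊕ (∂ a ∗ b) (a ∗ ∂ b) c n) ⟩
  ((∂ a ∗ b) ∗ c) n + ((a ∗ ∂ b) ∗ c) n + ((a ∗ b) ∗ ∂ c) n
    ≡⟨ cong₂ _+_ (cong₂ _+_ (∗-assoc (∂ a) b c n) (∗-assoc a (∂ b) c n)) (∗-assoc a b (∂ c) n) ⟩
  (∂ a ∗ (b ∗ c)) n + (a ∗ (∂ b ∗ c)) n + (a ∗ (b ∗ ∂ c)) n
    ≡⟨ +-assoc ((∂ a ∗ (b ∗ c)) n) _ _ ⟩
  (∂ a ∗ (b ∗ c)) n + ((a ∗ (∂ b ∗ c)) n + (a ∗ (b ∗ ∂ c)) n)
    ≡⟨ cong ((∂ a ∗ (b ∗ c)) n +_) (∗-distribˡ-⊕ a (∂ b ∗ c) (b ∗ ∂ c) n) ⟨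
  (∂ a ∗ (b ∗ c)) n + (a ∗ (∂ b ∗ c ⊕ b ∗ ∂ c)) n ∎

-- Orders of vanishing and leading coefficients of products.

Vanishes : Series → ℕ → Set
Vanishes a m = ∀ i → i < m → a i ≡ 0ℚ

∗-leading₀ : ∀ a b m → Vanishes b m → (a ∗ b) m ≡ a 0 * b m
∗-leading₀ a b zero    v = refl
∗-leading₀ a b (suc m) v = begin
  (∂ a ∗ b) m + (a ∗ ∂ b) m    ≡⟨ cong₂ _+_ (∗-leading₀ (∂ a) b m (λ i → v i ∘ ℕ.m<n⇒m<1+n))
                                            (∗-leading₀ a (∂ b) m (λ i → v (suc i) ∘ s<s)) ⟩
  a 1 * b m + a 0 * b (suc m)  ≡⟨ cong (λ x → a 1 * x + a 0 * b (suc m)) (v m (ℕ.n<1+n m)) ⟩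
  a 1 * 0ℚ + a 0 * b (suc m)   ≡⟨ cong (_+ a 0 * b (suc m)) (*-zeroʳ (a 1)) ⟩
  0ℚ + a 0 * b (suc m)         ≡⟨ +-identityˡ _ ⟩
  a 0 * b (suc m)              ∎

∗-vanishes : ∀ a b m → Vanishes b m → Vanishes (a ∗ b) m
∗-vanishes a b m v i i<m = begin
  (a ∗ b) i  ≡⟨ ∗-leading₀ a b i (λ j j<i → v j (ℕ.<-trans j<i i<m)) ⟩
  a 0 * b i  ≡⟨ cong (a 0 *_) (v i i<m) ⟩
  a 0 * 0ℚ   ≡⟨ *-zeroʳ (a 0) ⟩
  0ℚ         ∎

-- Exactly one derivative must fall on `a`, and it can be any of the m + 1: the first, in `∂ a ∗ b`,
-- or one of the remaining m, counted by induction in `a ∗ ∂ b`.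
∗-leading₁ : ∀ a b m → a 0 ≡ 0ℚ → Vanishes b m → (a ∗ b) (suc m) ≡ fromℕ (suc m) * (a 1 * b m)
∗-leading₁ a b m a₀ v = begin
  (∂ a ∗ b) m + (a ∗ ∂ b) m                     ≡⟨ cong₂ _+_ (∗-leading₀ (∂ a) b m v) (rest m v) ⟩
  a 1 * b m + fromℕ m * (a 1 * b m)             ≡⟨ cong (_+ fromℕ m * (a 1 * b m)) (*-identityˡ (a 1 * b m)) ⟨
  1ℚ * (a 1 * b m) + fromℕ m * (a 1 * b m)      ≡⟨ *-distribʳ-+ (a 1 * b m) 1ℚ (fromℕ m) ⟨
  (1ℚ + fromℕ m) * (a 1 * b m)                  ≡⟨ cong (_* (a 1 * b m)) (fromℕ-suc m) ⟨
  fromℕ (suc m) * (a 1 * b m)                   ∎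
  where
  rest : ∀ m → Vanishes b m → (a ∗ ∂ b) m ≡ fromℕ m * (a 1 * b m)
  rest zero    _ = trans (cong (_* b 1) a₀) (trans (*-zeroˡ (b 1)) (sym (*-zeroˡ (a 1 * b 0))))
  rest (suc m) v = ∗-leading₁ a (∂ b) m a₀ (λ i → v (suc i) ∘ s<s)

∗-identityˡ : ∀ a → 1ₛ ∗ a ≗ a
∗-identityˡ a zero    = *-identityˡ (a 0)
∗-identityˡ a (suc n) = begin
  (∂ 1ₛ ∗ a) n + (1ₛ ∗ ∂ a) n   ≡⟨ cong₂ _+_ (∗-comm (∂ 1ₛ) a n) (∗-identityˡ (∂ a) n) ⟩
  (a ∗ ∂ 1ₛ) n + a (suc n)      ≡⟨ cong (_+ a (suc n)) (∗-vanishes a (∂ 1ₛ) (suc n) (λ _ _ → refl) n (ℕ.n<1+n n)) ⟩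
  0ℚ + a (suc n)                ≡⟨ +-identityˡ _ ⟩
  a (suc n)                     ∎

-- Cauchy products and binomial sums as Leibniz products.

toEGF : Series → Series
toEGF f n = fromℕ (n !) * f n

-- This is d/dt on ordinary coefficients, as opposed to `∂`.
ϑ : Series → Series
ϑ f n = fromℕ (suc n) * f (suc n)

-- The factor n + 1 splits at index i as i + (n + 1 - i). The first part kills the term i = 0, the
-- second the term i = n + 1, which leaves two sums of the right length.
⊛-Leibniz : ∀ f g n → ϑ (f ⊛ g) n ≡ (ϑ f ⊛ g) n + (f ⊛ ϑ g) n
⊛-Leibniz f g n = begin
  s * ∑< (2 ℕ.+ n) t
    ≡⟨ ∑<-* (2 ℕ.+ n) s t ⟨
  ∑< (2 ℕ.+ n) (λ i → s * t i)
    ≡⟨ ∑<-cong (2 ℕ.+ n) (λ i i<2+n → splitIndex i (s≤s⁻¹ i<2+n)) ⟩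
  ∑< (2 ℕ.+ n) (λ i → u i + v i)
    ≡⟨ ∑<-+ (2 ℕ.+ n) u v ⟩
  ∑< (2 ℕ.+ n) u + ∑< (2 ℕ.+ n) v
    ≡⟨ cong₂ _+_ first second ⟩
  (ϑ f ⊛ g) n + (f ⊛ ϑ g) n ∎
  where
  s = fromℕ (suc n)
  t u v : ℕ → ℚ
  t i = f i * g (suc n ∸ i)
  u i = fromℕ i * f i * g (suc n ∸ i)
  v i = f i * (fromℕ (suc n ∸ i) * g (suc n ∸ i))
  expand : ∀ s i x y → s * (x * y) ≡ i * x * y + x * ((s - i) * y)
  expand = solve-∀ ℚ-ring
  splitIndex : ∀ i → i ≤ suc n → s * t i ≡ u i + v i
  splitIndex i i≤1+n = trans (expand s (fromℕ i) (f i) (g (suc n ∸ i)))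
    (cong (λ x → u i + f i * (x * g (suc n ∸ i))) (sym (fromℕ-∸ i≤1+n)))
  first : ∑< (2 ℕ.+ n) u ≡ (ϑ f ⊛ g) n
  first = trans (cong (_+ (ϑ f ⊛ g) n) (trans (cong (_* g (suc n)) (*-zeroˡ (f 0))) (*-zeroˡ (g (suc n)))))
                (+-identityˡ _)
  v-last : v (suc n) ≡ 0ℚ
  v-last = trans (cong (λ k → f (suc n) * (fromℕ k * g k)) (ℕ.n∸n≡0 n))
                 (trans (cong (f (suc n) *_) (*-zeroˡ (g 0))) (*-zeroʳ (f (suc n))))
  second : ∑< (2 ℕ.+ n) v ≡ (f ⊛ ϑ g) n
  second = begin
    ∑< (2 ℕ.+ n) v               ≡⟨ ∑<-last (suc n) v ⟩
    ∑< (suc n) v + v (suc n)     ≡⟨ cong (∑< (suc n) v +_) v-last ⟩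
    ∑< (suc n) v + 0ℚ            ≡⟨ +-identityʳ _ ⟩
    ∑< (suc n) v                 ≡⟨ ∑<-cong (suc n) (λ i i<1+n → cong (λ k → f i * (fromℕ k * g k)) (∸-suc i<1+n)) ⟩
    (f ⊛ ϑ g) n                  ∎

toEGF-ϑ : ∀ f → toEGF (ϑ f) ≗ ∂ (toEGF f)
toEGF-ϑ f n = begin
  fromℕ (n !) * (fromℕ (suc n) * f (suc n))  ≡⟨ rearrange (fromℕ (n !)) (fromℕ (suc n)) (f (suc n)) ⟩
  fromℕ (suc n) * fromℕ (n !) * f (suc n)    ≡⟨ cong (_* f (suc n)) (fromℕ-* (suc n) (n !)) ⟨
  fromℕ (suc n !) * f (suc n)                ∎
  where
  rearrange : ∀ x y z → x * (y * z) ≡ y * x * z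
  rearrange = solve-∀ ℚ-ring

-- Both products obey the Leibniz rule and `toEGF` carries `ϑ` to `∂`, so agreement at index 0
-- propagates.
toEGF-⊛ : ∀ f g → toEGF (f ⊛ g) ≗ toEGF f ∗ toEGF g
toEGF-⊛ f g zero    = unit (f 0) (g 0)
  where
  unit : ∀ x y → 1ℚ * (x * y + 0ℚ) ≡ 1ℚ * x * (1ℚ * y)
  unit = solve-∀ ℚ-ring
toEGF-⊛ f g (suc n) = begin
  toEGF (f ⊛ g) (suc n)
    ≡⟨ toEGF-ϑ (f ⊛ g) n ⟨
  fromℕ (n !) * ϑ (f ⊛ g) n
    ≡⟨ cong (fromℕ (n !) *_) (⊛-Leibniz f g n) ⟩
  fromℕ (n !) * ((ϑ f ⊛ g) n + (f ⊛ ϑ g) n)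
    ≡⟨ *-distribˡ-+ (fromℕ (n !)) _ _ ⟩
  toEGF (ϑ f ⊛ g) n + toEGF (f ⊛ ϑ g) n
    ≡⟨ cong₂ _+_ (toEGF-⊛ (ϑ f) g n) (toEGF-⊛ f (ϑ g) n) ⟩
  (toEGF (ϑ f) ∗ toEGF g) n + (toEGF f ∗ toEGF (ϑ g)) n
    ≡⟨ cong₂ _+_ (∗-congʳ (toEGF-ϑ f) n) (∗-congˡ (toEGF-ϑ g) n) ⟩
  (toEGF f ∗ toEGF g) (suc n) ∎

-- Pascal's rule is the Leibniz rule of the binomial convolution: the part with `n C k`
-- differentiates `a`, the part with `n C suc k` differentiates `b`.
∑-binomial-∗ : ∀ a b n → ∑< (suc n) (λ k → fromℕ (n C k) * a k * b (n ∸ k)) ≡ (a ∗ b) n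
∑-binomial-∗ a b zero    = unit (a 0) (b 0)
  where
  unit : ∀ x y → 1ℚ * x * y + 0ℚ ≡ x * y
  unit = solve-∀ ℚ-ring
∑-binomial-∗ a b (suc n) = begin
  h (suc n) + ∑< (suc n) (λ k → fromℕ (suc n C suc k) * a (suc k) * b (n ∸ k))
    ≡⟨ cong (h (suc n) +_) (∑<-cong (suc n) (λ k _ → pascal k)) ⟩
  h (suc n) + ∑< (suc n) (λ k → u k + v (suc k))
    ≡⟨ cong (h (suc n) +_) (∑<-+ (suc n) u (v ∘ suc)) ⟩
  h (suc n) + (∑< (suc n) u + ∑< (suc n) (v ∘ suc))
    -- The k = 0 term has coefficient 1 in every row, so it serves as the missing `v 0`.
    ≡⟨ swap (h (suc n)) (∑< (suc n) u) (∑< (suc n) (v ∘ suc)) ⟩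
  ∑< (suc n) u + ∑< (2 ℕ.+ n) v
    ≡⟨ cong₂ _+_ (∑-binomial-∗ (∂ a) b n) second ⟩
  (∂ a ∗ b) n + (a ∗ ∂ b) n ∎
  where
  h u v : ℕ → ℚ
  h m = fromℕ (m C 0) * a 0 * b (suc n)
  u k = fromℕ (n C k) * a (suc k) * b (n ∸ k)
  v k = fromℕ (n C k) * a k * b (suc n ∸ k)
  swap : ∀ x y z → x + (y + z) ≡ y + (x + z)
  swap = solve-∀ ℚ-ring
  expand : ∀ x y z w → (x + y) * z * w ≡ x * z * w + y * z * w
  expand = solve-∀ ℚ-ring
  pascal : ∀ k → fromℕ (suc n C suc k) * a (suc k) * b (n ∸ k) ≡ u k + v (suc k)
  pascal k = begin
    fromℕ (suc n C suc k) * a (suc k) * b (n ∸ k)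
      ≡⟨ cong (λ m → fromℕ m * a (suc k) * b (n ∸ k)) (nCk+nC[k+1]≡[n+1]C[k+1] n k) ⟨
    fromℕ (n C k ℕ.+ n C suc k) * a (suc k) * b (n ∸ k)
      ≡⟨ cong (λ x → x * a (suc k) * b (n ∸ k)) (fromℕ-+ (n C k) (n C suc k)) ⟩
    (fromℕ (n C k) + fromℕ (n C suc k)) * a (suc k) * b (n ∸ k)
      ≡⟨ expand (fromℕ (n C k)) (fromℕ (n C suc k)) (a (suc k)) (b (n ∸ k)) ⟩
    u k + v (suc k) ∎
  zeroTerm : ∀ x y → 0ℚ * x * y ≡ 0ℚ
  zeroTerm = solve-∀ ℚ-ring
  v-last : v (suc n) ≡ 0ℚ
  v-last = trans (cong (λ m → fromℕ m * a (suc n) * b (n ∸ n)) (k>n⇒nCk≡0 (ℕ.n<1+n n)))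
                 (zeroTerm (a (suc n)) (b (n ∸ n)))
  second : ∑< (2 ℕ.+ n) v ≡ (a ∗ ∂ b) n
  second = begin
    ∑< (2 ℕ.+ n) v            ≡⟨ ∑<-last (suc n) v ⟩
    ∑< (suc n) v + v (suc n)  ≡⟨ cong (∑< (suc n) v +_) v-last ⟩
    ∑< (suc n) v + 0ℚ         ≡⟨ +-identityʳ _ ⟩
    ∑< (suc n) v              ≡⟨ ∑<-cong (suc n) (λ k k<1+n → cong (λ m → fromℕ (n C k) * a k * b m) (∸-suc k<1+n)) ⟩
    ∑< (suc n) (λ k → fromℕ (n C k) * a k * b (suc (n ∸ k)))  ≡⟨ ∑-binomial-∗ a (∂ b) n ⟩
    (a ∗ ∂ b) n               ∎

-- Stirling numbers of the second kind.

E : Series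
E zero    = 0ℚ
E (suc _) = 1ℚ

toEGF-exp-1 : toEGF exp-1 ≗ E
toEGF-exp-1 zero    = refl
toEGF-exp-1 (suc n) = trans (simplify (fromℕ (suc n !)) (1/! (suc n))) (1/!-! (suc n))
  where
  simplify : ∀ x y → x * (1ℚ * y - 0ℚ) ≡ y * x
  simplify = solve-∀ ℚ-ring

∂E-∗ : ∀ a n → (∂ E ∗ a) n ≡ a n + (E ∗ a) n
∂E-∗ a n = begin
  (∂ E ∗ a) n               ≡⟨ ∗-congʳ ∂E n ⟩
  ((1ₛ ⊕ E) ∗ a) n          ≡⟨ ∗-distribʳ-⊕ 1ₛ E a n ⟩
  (1ₛ ∗ a) n + (E ∗ a) n    ≡⟨ cong (_+ (E ∗ a) n) (∗-identityˡ a n) ⟩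
  a n + (E ∗ a) n           ∎
  where
  ∂E : ∂ E ≗ 1ₛ ⊕ E
  ∂E zero    = refl
  ∂E (suc _) = refl

-- Column k of the Stirling triangle as a series: Eᵏ / k!.
S : ℕ → Series
S k n = stirling₂ n k

S-zero : S 0 ≗ 1ₛ
S-zero zero    = refl
S-zero (suc n) = *-zeroʳ (fromℕ (suc n !))

E-∗-S : ∀ k n → (E ∗ S k) n ≡ fromℕ (suc k) * S (suc k) n
E-∗-S k n = begin
  (E ∗ S k) n                        ≡⟨ ∗-congˡ (λ m → scale (fromℕ (m !)) (P m) (1/! k)) n ⟩
  (E ∗ (1/! k · toEGF P)) n          ≡⟨ ∗-· (1/! k) E (toEGF P) n ⟩
  1/! k * (E ∗ toEGF P) n            ≡⟨ cong₂ _*_ (sym (1/!-suc k)) (∗-congʳ (sym ∘ toEGF-exp-1) n) ⟩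
  s * i * (toEGF exp-1 ∗ toEGF P) n  ≡⟨ cong (s * i *_) (toEGF-⊛ exp-1 P n) ⟨
  s * i * (fromℕ (n !) * (exp-1 ⊛ P) n)  ≡⟨ rearrange s i (fromℕ (n !)) ((exp-1 ⊛ P) n) ⟩
  s * S (suc k) n                    ∎
  where
  P = exp-1 ^ₛ k
  s = fromℕ (suc k)
  i = 1/! (suc k)
  scale : ∀ x y z → x * (y * z) ≡ z * (x * y)
  scale = solve-∀ ℚ-ring
  rearrange : ∀ s i f x → s * i * (f * x) ≡ s * (f * (x * i))
  rearrange = solve-∀ ℚ-ring

-- Induction on k, intertwined with `S-rec`, takes the place of a power rule for derivatives.
-- Differentiating `E-∗-S` at k yields `S-rec` at k, provided E times the derivative of `S k` is
-- known; that in turn comes from `S-rec` at k - 1.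
E-∗-∂S : ∀ k n → (E ∗ ∂ (S k)) n ≡ fromℕ k * (fromℕ (suc k) * S (suc k) n + S k n)
S-rec : ∀ k n → S (suc k) (suc n) ≡ fromℕ (suc k) * S (suc k) n + S k n

E-∗-∂S zero n = begin
  (E ∗ ∂ (S 0)) n   ≡⟨ ∗-congˡ (S-zero ∘ suc) n ⟩
  (E ∗ ∂ 1ₛ) n      ≡⟨ ∗-vanishes E (∂ 1ₛ) (suc n) (λ _ _ → refl) n (ℕ.n<1+n n) ⟩
  0ℚ                ≡⟨ *-zeroˡ (fromℕ 1 * S 1 n + S 0 n) ⟨
  0ℚ * (fromℕ 1 * S 1 n + S 0 n) ∎
E-∗-∂S (suc k) n = begin
  (E ∗ ∂ (S (suc k))) n
    ≡⟨ ∗-congˡ (S-rec k) n ⟩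
  (E ∗ (s · S (suc k) ⊕ S k)) n
    ≡⟨ ∗-distribˡ-⊕ E (s · S (suc k)) (S k) n ⟩
  (E ∗ (s · S (suc k))) n + (E ∗ S k) n
    ≡⟨ cong₂ _+_ (trans (∗-· s E (S (suc k)) n) (cong (s *_) (E-∗-S (suc k) n))) (E-∗-S k n) ⟩
  s * (fromℕ (2 ℕ.+ k) * S (2 ℕ.+ k) n) + s * S (suc k) n
    ≡⟨ *-distribˡ-+ s _ _ ⟨
  s * (fromℕ (2 ℕ.+ k) * S (2 ℕ.+ k) n + S (suc k) n) ∎
  where s = fromℕ (suc k)

S-rec k n = fromℕ-suc-cancel k (begin
  s * S (suc k) (suc n)
    ≡⟨ E-∗-S k (suc n) ⟨
  (∂ E ∗ S k) n + (E ∗ ∂ (S k)) n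
    ≡⟨ cong₂ _+_ (∂E-∗ (S k) n) (E-∗-∂S k n) ⟩
  S k n + (E ∗ S k) n + fromℕ k * (s * S (suc k) n + S k n)
    ≡⟨ cong (λ x → S k n + x + fromℕ k * (s * S (suc k) n + S k n)) (E-∗-S k n) ⟩
  S k n + s * S (suc k) n + fromℕ k * (s * S (suc k) n + S k n)
    ≡⟨ collect (fromℕ k) (S k n) (s * S (suc k) n) ⟩
  (1ℚ + fromℕ k) * (s * S (suc k) n + S k n)
    ≡⟨ cong (_* (s * S (suc k) n + S k n)) (fromℕ-suc k) ⟨
  s * (s * S (suc k) n + S k n) ∎)
  where
  s = fromℕ (suc k)
  collect : ∀ k x y → x + y + k * (y + x) ≡ (1ℚ + k) * (y + x)
  collect = solve-∀ ℚ-ring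

S-vanishes : ∀ k → Vanishes (S k) k
S-vanishes (suc k) zero    _ = fromℕ-suc-cancel k (begin
  fromℕ (suc k) * S (suc k) 0  ≡⟨ E-∗-S k 0 ⟨
  0ℚ * S k 0                   ≡⟨ *-zeroˡ (S k 0) ⟩
  0ℚ                           ≡⟨ *-zeroʳ (fromℕ (suc k)) ⟨
  fromℕ (suc k) * 0ℚ           ∎)
S-vanishes (suc k) (suc i) (s<s i<k) = begin
  S (suc k) (suc i)                     ≡⟨ S-rec k i ⟩
  fromℕ (suc k) * S (suc k) i + S k i   ≡⟨ cong₂ (λ x y → fromℕ (suc k) * x + y)
                                             (S-vanishes (suc k) i (ℕ.m<n⇒m<1+n i<k)) (S-vanishes k i i<k) ⟩
  fromℕ (suc k) * 0ℚ + 0ℚ               ≡⟨ cong (_+ 0ℚ) (*-zeroʳ (fromℕ (suc k))) ⟩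
  0ℚ                                    ∎

S-diagonal : ∀ k → S k k ≡ 1ℚ
S-diagonal zero    = refl
S-diagonal (suc k) = begin
  S (suc k) (suc k)                     ≡⟨ S-rec k k ⟩
  fromℕ (suc k) * S (suc k) k + S k k   ≡⟨ cong₂ (λ x y → fromℕ (suc k) * x + y)
                                             (S-vanishes (suc k) k (ℕ.n<1+n k)) (S-diagonal k) ⟩
  fromℕ (suc k) * 0ℚ + 1ℚ               ≡⟨ cong (_+ 1ℚ) (*-zeroʳ (fromℕ (suc k))) ⟩
  1ℚ                                    ∎

-- Uniqueness for the recursion in p.

-- The recursion of the p-Bernoulli numbers times Eᵖ⁺² / (p+1)!, in terms of
-- X p = Eᵖ⁺¹ F_p / (p+1)!.
Recursive : (ℕ → Series) → Set
Recursive X = ∀ p n → (E ∗ ∂ (X p)) n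
  ≡ fromℕ (suc p) * X p n + (fromℕ (suc p) + fromℕ p) * (E ∗ X p) n
    - fromℕ (suc p) * fromℕ (suc p) * X (suc p) n

-- The relation is linear and homogeneous in the family, with constants that depend on p alone.
Recursive-difference : ∀ {X Y} → Recursive X → Recursive Y → Recursive (λ p → X p ⊕ - 1ℚ · Y p)
Recursive-difference {X} {Y} recX recY p n = begin
  (E ∗ (∂ (X p) ⊕ - 1ℚ · ∂ (Y p))) n
    ≡⟨ minus (∂ (X p)) (∂ (Y p)) ⟩
  (E ∗ ∂ (X p)) n + - 1ℚ * (E ∗ ∂ (Y p)) n
    ≡⟨ cong₂ (λ x y → x + - 1ℚ * y) (recX p n) (recY p n) ⟩
  s * X p n + t * (E ∗ X p) n - s * s * X (suc p) n
    + - 1ℚ * (s * Y p n + t * (E ∗ Y p) n - s * s * Y (suc p) n)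
    ≡⟨ collect s t (X p n) ((E ∗ X p) n) (X (suc p) n) (Y p n) ((E ∗ Y p) n) (Y (suc p) n) ⟩
  s * (X p n + - 1ℚ * Y p n) + t * ((E ∗ X p) n + - 1ℚ * (E ∗ Y p) n)
    - s * s * (X (suc p) n + - 1ℚ * Y (suc p) n)
    ≡⟨ cong (λ x → s * (X p n + - 1ℚ * Y p n) + t * x - s * s * (X (suc p) n + - 1ℚ * Y (suc p) n))
            (minus (X p) (Y p)) ⟨
  s * (X p n + - 1ℚ * Y p n) + t * (E ∗ (X p ⊕ - 1ℚ · Y p)) n
    - s * s * (X (suc p) n + - 1ℚ * Y (suc p) n) ∎
  where
  s = fromℕ (suc p)
  t = fromℕ (suc p) + fromℕ p
  minus : ∀ a b → (E ∗ (a ⊕ - 1ℚ · b)) n ≡ (E ∗ a) n + - 1ℚ * (E ∗ b) n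
  minus a b = trans (∗-distribˡ-⊕ E a (- 1ℚ · b) n) (cong ((E ∗ a) n +_) (∗-· (- 1ℚ) E b n))
  collect : ∀ s t a b c a′ b′ c′ →
    s * a + t * b - s * s * c + - 1ℚ * (s * a′ + t * b′ - s * s * c′)
      ≡ s * (a + - 1ℚ * a′) + t * (b + - 1ℚ * b′) - s * s * (c + - 1ℚ * c′)
  collect = solve-∀ ℚ-ring

-- If every X p vanishes below m = k + p + 2, then at index m the recursion
-- reads m · X p m ≡ (p + 1) · X p m.
Recursive-vanishes : ∀ {X} → Recursive X → (∀ p → Vanishes (X p) (2 ℕ.+ p)) →
                     ∀ k p → Vanishes (X p) (suc k ℕ.+ suc p)
Recursive-vanishes         rec init zero    p = init p
Recursive-vanishes {X = X} rec init (suc k) p i i<m+1 with ℕ.m≤n⇒m<n∨m≡n (s≤s⁻¹ i<m+1)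
... | inj₁ i<m  = Recursive-vanishes rec init k p i i<m
... | inj₂ refl = fromℕ-suc-cancel k (begin
  fromℕ (suc k) * x                    ≡⟨ add-sub (fromℕ (suc k)) s x ⟩
  (fromℕ (suc k) + s) * x - s * x      ≡⟨ cong (λ y → y * x - s * x) (fromℕ-+ (suc k) (suc p)) ⟨
  fromℕ m * x - s * x                  ≡⟨ cong (_- s * x) leading ⟨
  (E ∗ ∂ (X p)) m - s * x              ≡⟨ cong (_- s * x) (rec p m) ⟩
  s * x + t * (E ∗ X p) m - s * s * X (suc p) m - s * x
    ≡⟨ cong₂ (λ y z → s * x + t * y - s * s * z - s * x) E∗X≡0 next ⟩
  s * x + t * 0ℚ - s * s * 0ℚ - s * x  ≡⟨ cancel (fromℕ (suc k)) s t x ⟩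
  fromℕ (suc k) * 0ℚ                   ∎)
  where
  m = suc k ℕ.+ suc p
  x = X p m
  s = fromℕ (suc p)
  t = fromℕ (suc p) + fromℕ p
  IH : ∀ q → Vanishes (X q) (suc k ℕ.+ suc q)
  IH = Recursive-vanishes rec init k
  add-sub : ∀ k s x → k * x ≡ (k + s) * x - s * x
  add-sub = solve-∀ ℚ-ring
  cancel : ∀ k s t x → s * x + t * 0ℚ - s * s * 0ℚ - s * x ≡ k * 0ℚ
  cancel = solve-∀ ℚ-ring
  leading : (E ∗ ∂ (X p)) m ≡ fromℕ m * x
  leading = trans (∗-leading₁ E (∂ (X p)) (k ℕ.+ suc p) refl (λ j → IH p (suc j) ∘ s<s))
                  (cong (fromℕ m *_) (*-identityˡ x))
  E∗X≡0 : (E ∗ X p) m ≡ 0ℚ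
  E∗X≡0 = trans (∗-leading₀ E (X p) m (IH p)) (*-zeroˡ x)
  next : X (suc p) m ≡ 0ℚ
  next = IH (suc p) m (s<s (ℕ.+-monoʳ-< k (ℕ.n<1+n (suc p))))

-- Two families satisfying the recursion.

G : ℕ → Series
G p = S (suc p) ∗ (λ n → B n p)

-- In ∂G the coefficient 2p + 1 collects p + 1 from `S-rec` and p from the recursion of `B`.
-- Multiplying by E raises the index of each Stirling column (`E-∗-S`): the stray `S p ∗ F p`
-- becomes (p+1) G_p, and the other term acquires the p + 2 that clears the denominator of `c`.
G-Recursive : Recursive G
G-Recursive p n = begin
  (E ∗ ∂ (G p)) n
    ≡⟨ ∗-congˡ ∂G n ⟩
  (E ∗ (t · G p ⊕ S p ∗ F p ⊕ (- c) · (S (suc p) ∗ F (suc p)))) n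
    ≡⟨ ∗-distribˡ-⊕ E (t · G p ⊕ S p ∗ F p) ((- c) · (S (suc p) ∗ F (suc p))) n ⟩
  (E ∗ (t · G p ⊕ S p ∗ F p)) n + (E ∗ ((- c) · (S (suc p) ∗ F (suc p)))) n
    ≡⟨ cong₂ _+_ (∗-distribˡ-⊕ E (t · G p) (S p ∗ F p) n) (∗-· (- c) E (S (suc p) ∗ F (suc p)) n) ⟩
  (E ∗ (t · G p)) n + (E ∗ (S p ∗ F p)) n + - c * (E ∗ (S (suc p) ∗ F (suc p))) n
    ≡⟨ cong₂ (λ y z → (y + (E ∗ (S p ∗ F p)) n) + - c * z)
             (∗-· t E (G p) n) (E-∗-S-∗ (suc p) (F (suc p))) ⟩
  t * (E ∗ G p) n + (E ∗ (S p ∗ F p)) n + - c * (fromℕ (2 ℕ.+ p) * G (suc p) n)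
    ≡⟨ cong (λ y → t * (E ∗ G p) n + y + - c * (fromℕ (2 ℕ.+ p) * G (suc p) n)) (E-∗-S-∗ p (F p)) ⟩
  t * (E ∗ G p) n + s * G p n + - c * (fromℕ (2 ℕ.+ p) * G (suc p) n)
    ≡⟨ collect s t c (fromℕ (2 ℕ.+ p)) (G p n) ((E ∗ G p) n) (G (suc p) n) ⟩
  s * G p n + t * (E ∗ G p) n - c * fromℕ (2 ℕ.+ p) * G (suc p) n
    ≡⟨ cong (λ y → s * G p n + t * (E ∗ G p) n - y * G (suc p) n) c-value ⟩
  s * G p n + t * (E ∗ G p) n - s * s * G (suc p) n ∎
  where
  F : ℕ → Series
  F p n = B n p
  s = fromℕ (suc p)
  t = fromℕ (suc p) + fromℕ p
  c = pos (suc p ^ 2) / suc (suc p)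
  c-value : c * fromℕ (2 ℕ.+ p) ≡ s * s
  c-value = begin
    c * fromℕ (2 ℕ.+ p)         ≡⟨ /-*-fromℕ (suc p ^ 2) (2 ℕ.+ p) ⟩
    fromℕ (suc p ^ 2)           ≡⟨ fromℕ-* (suc p) (suc p ^ 1) ⟩
    s * fromℕ (suc p ^ 1)       ≡⟨ cong (λ m → s * fromℕ m) (ℕ.*-identityʳ (suc p)) ⟩
    s * s                       ∎
  E-∗-S-∗ : ∀ k a → (E ∗ (S k ∗ a)) n ≡ fromℕ (suc k) * (S (suc k) ∗ a) n
  E-∗-S-∗ k a = begin
    (E ∗ (S k ∗ a)) n                   ≡⟨ ∗-assoc E (S k) a n ⟨
    ((E ∗ S k) ∗ a) n                   ≡⟨ ∗-congʳ (E-∗-S k) n ⟩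
    ((fromℕ (suc k) · S (suc k)) ∗ a) n ≡⟨ ·-∗ (fromℕ (suc k)) (S (suc k)) a n ⟩
    fromℕ (suc k) * (S (suc k) ∗ a) n   ∎
  collectG : ∀ s p c g h k → s * g + h + (p * g + - c * k) ≡ (s + p) * g + h + - c * k
  collectG = solve-∀ ℚ-ring
  neg : ∀ p c x y → p * x - c * y ≡ p * x + - c * y
  neg = solve-∀ ℚ-ring
  ∂G : ∂ (G p) ≗ t · G p ⊕ S p ∗ F p ⊕ (- c) · (S (suc p) ∗ F (suc p))
  ∂G n = begin
    (∂ (S (suc p)) ∗ F p) n + (S (suc p) ∗ ∂ (F p)) n
      ≡⟨ cong₂ _+_ (∗-congʳ (S-rec p) n) (∗-congˡ (λ m → neg (fromℕ p) c (B m p) (B m (suc p))) n) ⟩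
    ((s · S (suc p) ⊕ S p) ∗ F p) n + (S (suc p) ∗ (fromℕ p · F p ⊕ (- c) · F (suc p))) n
      ≡⟨ cong₂ _+_ (∗-distribʳ-⊕ (s · S (suc p)) (S p) (F p) n)
                   (∗-distribˡ-⊕ (S (suc p)) (fromℕ p · F p) ((- c) · F (suc p)) n) ⟩
    ((s · S (suc p)) ∗ F p) n + (S p ∗ F p) n
      + ((S (suc p) ∗ (fromℕ p · F p)) n + (S (suc p) ∗ ((- c) · F (suc p))) n)
      ≡⟨ cong₂ (λ y z → y + (S p ∗ F p) n + z) (·-∗ s (S (suc p)) (F p) n)
           (cong₂ _+_ (∗-· (fromℕ p) (S (suc p)) (F p) n) (∗-· (- c) (S (suc p)) (F (suc p)) n)) ⟩
    s * G p n + (S p ∗ F p) n + (fromℕ p * G p n + - c * (S (suc p) ∗ F (suc p)) n)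
      ≡⟨ collectG s (fromℕ p) c (G p n) ((S p ∗ F p) n) ((S (suc p) ∗ F (suc p)) n) ⟩
    t * G p n + (S p ∗ F p) n + - c * (S (suc p) ∗ F (suc p)) n ∎
  collect : ∀ s t c q x y z → t * y + s * x + - c * (q * z) ≡ s * x + t * y - c * q * z
  collect = solve-∀ ℚ-ring

-- As a function this is eᵖᵗ times the integral of (1 - e⁻ᵘ)ᵖ / p! over u from 0 to t; only the
-- coefficient form of its differential equation is used.
R : ℕ → Series
R p zero    = 0ℚ
R p (suc n) = fromℕ p * R p n + S p n

E-∗-∂R : ∀ p n → (E ∗ ∂ (R p)) n ≡ fromℕ p * (E ∗ R p) n + fromℕ (suc p) * S (suc p) n
E-∗-∂R p n = trans (∗-distribˡ-⊕ E (fromℕ p · R p) (S p) n)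
                   (cong₂ _+_ (∗-· (fromℕ p) E (R p) n) (E-∗-S p n))

-- Both sides vanish at t = 0 and satisfy y′ = (p + 1) y + Eᵖ⁺¹ / p!.
R-suc : ∀ p n → fromℕ (suc p) * R (suc p) n ≡ R p n + (E ∗ R p) n - S (suc p) n
R-suc p zero    = begin
  s * 0ℚ                            ≡⟨ *-zeroʳ s ⟩
  0ℚ                                ≡⟨⟩
  0ℚ + 0ℚ * 0ℚ - 0ℚ                 ≡⟨ cong (λ x → 0ℚ + 0ℚ * 0ℚ - x) (S-vanishes (suc p) 0 z<s) ⟨
  0ℚ + 0ℚ * 0ℚ - S (suc p) 0        ∎
  where s = fromℕ (suc p)
R-suc p (suc n) = begin
  s * (s * R (suc p) n + σ)
    ≡⟨ cong (λ x → s * (x + σ)) (R-suc p n) ⟩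
  s * (r + e - σ + σ)
    ≡⟨ cong (_* (r + e - σ + σ)) (fromℕ-suc p) ⟩
  (1ℚ + fromℕ p) * (r + e - σ + σ)
    ≡⟨ rearrange (fromℕ p) r e (S p n) s σ ⟩
  fromℕ p * r + S p n + (r + e + (fromℕ p * e + s * σ)) - (s * σ + S p n)
    ≡⟨ cong₂ (λ x y → R p (suc n) + x - y) (cong₂ _+_ (∂E-∗ (R p) n) (E-∗-∂R p n)) (S-rec p n) ⟨
  R p (suc n) + (E ∗ R p) (suc n) - S (suc p) (suc n) ∎
  where
  s = fromℕ (suc p)
  r = R p n
  e = (E ∗ R p) n
  σ = S (suc p) n
  rearrange : ∀ p r e u s σ →
    (1ℚ + p) * (r + e - σ + σ) ≡ p * r + u + (r + e + (p * e + s * σ)) - (s * σ + u)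
  rearrange = solve-∀ ℚ-ring

-- The differential equation times E leaves a term (p+1) `S (suc p)`; `R-suc` trades it for R_{p+1},
-- which brings the second factor p + 1.
R-Recursive : Recursive R
R-Recursive p n = begin
  (E ∗ ∂ (R p)) n
    ≡⟨ E-∗-∂R p n ⟩
  fromℕ p * e + s * σ
    ≡⟨ rearrange (fromℕ p) s r e σ ⟩
  s * r + (s + fromℕ p) * e - s * (r + e - σ)
    ≡⟨ cong (λ x → s * r + (s + fromℕ p) * e - s * x) (R-suc p n) ⟨
  s * r + (s + fromℕ p) * e - s * (s * R (suc p) n)
    ≡⟨ cong (λ x → s * r + (s + fromℕ p) * e - x) (*-assoc s s (R (suc p) n)) ⟨
  s * r + (s + fromℕ p) * e - s * s * R (suc p) n ∎
  where
  s = fromℕ (suc p)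
  r = R p n
  e = (E ∗ R p) n
  σ = S (suc p) n
  rearrange : ∀ p s r e σ → p * e + s * σ ≡ s * r + (s + p) * e - s * (r + e - σ)
  rearrange = solve-∀ ℚ-ring

-- Leading terms, and the equality of the two families.

R-vanishes : ∀ p → Vanishes (R p) (suc p)
R-vanishes p zero    _         = refl
R-vanishes p (suc i) (s<s i<p) = begin
  fromℕ p * R p i + S p i  ≡⟨ cong₂ (λ x y → fromℕ p * x + y)
                                (R-vanishes p i (ℕ.m<n⇒m<1+n i<p)) (S-vanishes p i i<p) ⟩
  fromℕ p * 0ℚ + 0ℚ        ≡⟨ cong (_+ 0ℚ) (*-zeroʳ (fromℕ p)) ⟩
  0ℚ                       ∎

R-leading : ∀ p → R p (suc p) ≡ 1ℚ
R-leading p = begin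
  fromℕ p * R p p + S p p  ≡⟨ cong₂ (λ x y → fromℕ p * x + y) (R-vanishes p p (ℕ.n<1+n p)) (S-diagonal p) ⟩
  fromℕ p * 0ℚ + 1ℚ        ≡⟨ cong (_+ 1ℚ) (*-zeroʳ (fromℕ p)) ⟩
  1ℚ                       ∎

-- Moves the factor of high order to the right, where `∗-vanishes` and `∗-leading₀` expect it.
G-∗-comm : ∀ p n → G p n ≡ ((λ n → B n p) ∗ S (suc p)) n
G-∗-comm p = ∗-comm (S (suc p)) (λ n → B n p)

G-vanishes : ∀ p → Vanishes (G p) (suc p)
G-vanishes p i i<1+p = trans (G-∗-comm p i)
  (∗-vanishes (λ n → B n p) (S (suc p)) (suc p) (S-vanishes (suc p)) i i<1+p)

G-leading : ∀ p → G p (suc p) ≡ 1ℚ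
G-leading p = begin
  G p (suc p)                               ≡⟨ G-∗-comm p (suc p) ⟩
  ((λ n → B n p) ∗ S (suc p)) (suc p)       ≡⟨ ∗-leading₀ (λ n → B n p) (S (suc p)) (suc p) (S-vanishes (suc p)) ⟩
  1ℚ * S (suc p) (suc p)                    ≡⟨ *-identityˡ (S (suc p) (suc p)) ⟩
  S (suc p) (suc p)                         ≡⟨ S-diagonal (suc p) ⟩
  1ℚ                                        ∎

G≗R : ∀ p → G p ≗ R p
G≗R p n = begin
  G p n                                ≡⟨ split (G p n) (R p n) ⟩
  G p n + - 1ℚ * R p n + R p n         ≡⟨ cong (_+ R p n) difference≡0 ⟩
  0ℚ + R p n                           ≡⟨ +-identityˡ (R p n) ⟩
  R p n                                ∎
  where
  split : ∀ x y → x ≡ x + - 1ℚ * y + y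
  split = solve-∀ ℚ-ring
  init : ∀ p → Vanishes (G p ⊕ - 1ℚ · R p) (2 ℕ.+ p)
  init p i i<2+p with ℕ.m≤n⇒m<n∨m≡n (s≤s⁻¹ i<2+p)
  ... | inj₁ i<1+p = cong₂ (λ x y → x + - 1ℚ * y) (G-vanishes p i i<1+p) (R-vanishes p i i<1+p)
  ... | inj₂ refl  = cong₂ (λ x y → x + - 1ℚ * y) (G-leading p) (R-leading p)
  difference≡0 : (G p ⊕ - 1ℚ · R p) n ≡ 0ℚ
  -- Taking k = n is enough, as n < n + p + 2.
  difference≡0 = Recursive-vanishes (Recursive-difference {G} {R} G-Recursive R-Recursive) init n p n
    (s<s (ℕ.m≤m+n n (suc p)))

-- Closed form of `R` through weighted sums of wⱼ Eᵖ⁻ʲ / (p-j)!.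

W : ℕ → ℕ → (ℕ → ℚ) → ℚ
W n p w = ∑< (suc p) (λ j → S (p ∸ j) n * w j)

W-cong : ∀ n p {v w} → (∀ j → v j ≡ w j) → W n p v ≡ W n p w
W-cong n p eq = ∑<-cong (suc p) (λ j _ → cong (S (p ∸ j) n *_) (eq j))

W-⊕ : ∀ n p v w → W n p (v ⊕ w) ≡ W n p v + W n p w
W-⊕ n p v w = trans (∑<-cong (suc p) (λ j _ → *-distribˡ-+ (S (p ∸ j) n) (v j) (w j)))
                    (∑<-+ (suc p) (λ j → S (p ∸ j) n * v j) (λ j → S (p ∸ j) n * w j))

W-· : ∀ n p x w → W n p (x · w) ≡ x * W n p w
W-· n p x w = trans (∑<-cong (suc p) (λ j _ → pull x (S (p ∸ j) n) (w j)))
                    (∑<-* (suc p) x (λ j → S (p ∸ j) n * w j))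
  where
  pull : ∀ x y z → y * (x * z) ≡ x * (y * z)
  pull = solve-∀ ℚ-ring

-- At t = 0 only the zeroth power of E survives, that is j = p.
W-last : ∀ p w → W 0 p w ≡ w p
W-last p w = begin
  W 0 p w                           ≡⟨ ∑<-last p term ⟩
  ∑< p term + S (p ∸ p) 0 * w p     ≡⟨ cong₂ (λ x k → x + S k 0 * w p)
                                         (∑<-zero p (λ j j<p → trans (cong (_* w j) (S-vanishes (p ∸ j) 0 (ℕ.m<n⇒0<n∸m j<p)))
                                                                     (*-zeroˡ (w j))))
                                         (ℕ.n∸n≡0 p) ⟩
  0ℚ + 1ℚ * w p                     ≡⟨ simplify (w p) ⟩
  w p                               ∎
  where
  term = λ j → S (p ∸ j) 0 * w j
  simplify : ∀ x → 0ℚ + 1ℚ * x ≡ x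
  simplify = solve-∀ ℚ-ring

W-head : ∀ n p → W n p 1ₛ ≡ S p n
W-head n p = begin
  S p n * 1ℚ + ∑< p (λ j → S (p ∸ suc j) n * 0ℚ)  ≡⟨ cong₂ _+_ (*-identityʳ (S p n)) (∑<-zero p (λ j _ → *-zeroʳ (S (p ∸ suc j) n))) ⟩
  S p n + 0ℚ                                      ≡⟨ +-identityʳ (S p n) ⟩
  S p n                                           ∎

shift : (ℕ → ℚ) → ℕ → ℚ
shift w zero    = 0ℚ
shift w (suc j) = w j

-- Differentiation acts on the weights alone: by `S-rec`, the derivative of column p - j is p - j
-- times itself plus column p - (j + 1), so wⱼ is scaled by p - j and also passed on to place j + 1.
W-suc : ∀ n p w → W (suc n) p w ≡ W n p (λ j → (fromℕ p - fromℕ j) * w j + shift w j)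
W-suc n p w = begin
  W (suc n) p w
    ≡⟨ ∑<-last p (λ j → S (p ∸ j) (suc n) * w j) ⟩
  ∑< p (λ j → S (p ∸ j) (suc n) * w j) + S (p ∸ p) (suc n) * w p
    -- At j = p the column `S 0` is constant; its zero derivative agrees with `u p`, which has the
    -- factor p - p.
    ≡⟨ cong₂ _+_ (∑<-cong p recurse) last≡0 ⟩
  ∑< p (λ j → u j + v (suc j)) + u p
    ≡⟨ cong (_+ u p) (∑<-+ p u (v ∘ suc)) ⟩
  ∑< p u + ∑< p (v ∘ suc) + u p
    ≡⟨ swap (∑< p u) (∑< p (v ∘ suc)) (u p) ⟩
  ∑< p u + u p + (0ℚ + ∑< p (v ∘ suc))
    ≡⟨ cong₂ (λ x y → x + (y + ∑< p (v ∘ suc))) (sym (∑<-last p u)) (sym (*-zeroʳ (S p n))) ⟩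
  ∑< (suc p) u + ∑< (suc p) v
    ≡⟨ W-⊕ n p (λ j → (fromℕ p - fromℕ j) * w j) (shift w) ⟨
  W n p (λ j → (fromℕ p - fromℕ j) * w j + shift w j) ∎
  where
  u v : ℕ → ℚ
  u j = S (p ∸ j) n * ((fromℕ p - fromℕ j) * w j)
  v j = S (p ∸ j) n * shift w j
  swap : ∀ x y z → x + y + z ≡ x + z + (0ℚ + y)
  swap = solve-∀ ℚ-ring
  expand : ∀ d x y w → (d * x + y) * w ≡ x * (d * w) + y * w
  expand = solve-∀ ℚ-ring
  vanish : ∀ p s w → s * ((p - p) * w) ≡ 0ℚ * w
  vanish = solve-∀ ℚ-ring
  last≡0 : S (p ∸ p) (suc n) * w p ≡ u p
  last≡0 = begin
    S (p ∸ p) (suc n) * w p   ≡⟨ cong (λ k → S k (suc n) * w p) (ℕ.n∸n≡0 p) ⟩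
    S 0 (suc n) * w p         ≡⟨ cong (_* w p) (S-zero (suc n)) ⟩
    0ℚ * w p                  ≡⟨ vanish (fromℕ p) (S (p ∸ p) n) (w p) ⟨
    u p                       ∎
  recurse : ∀ j → j < p → S (p ∸ j) (suc n) * w j ≡ u j + v (suc j)
  recurse j j<p = begin
    S (p ∸ j) (suc n) * w j
      ≡⟨ cong (λ k → S k (suc n) * w j) p∸j ⟩
    S (suc (p ∸ suc j)) (suc n) * w j
      ≡⟨ cong (_* w j) (S-rec (p ∸ suc j) n) ⟩
    (fromℕ (suc (p ∸ suc j)) * S (suc (p ∸ suc j)) n + S (p ∸ suc j) n) * w j
      ≡⟨ cong (λ k → (fromℕ k * S k n + S (p ∸ suc j) n) * w j) p∸j ⟨
    (fromℕ (p ∸ j) * S (p ∸ j) n + S (p ∸ suc j) n) * w j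
      ≡⟨ cong (λ d → (d * S (p ∸ j) n + S (p ∸ suc j) n) * w j) (fromℕ-∸ (ℕ.<⇒≤ j<p)) ⟩
    ((fromℕ p - fromℕ j) * S (p ∸ j) n + S (p ∸ suc j) n) * w j
      ≡⟨ expand (fromℕ p - fromℕ j) (S (p ∸ j) n) (S (p ∸ suc j) n) (w j) ⟩
    u j + v (suc j) ∎
    where
    p∸j : p ∸ j ≡ suc (p ∸ suc j)
    p∸j = ℕ.+-∸-assoc 1 j<p

-- The binomial theorem for (1 + E)ᵖ, without binomials: since (p-j)/j! + 1/(j-1)! = p/j!, the
-- weights 1/j! are an eigenvector of differentiation with eigenvalue p.
power-expansion : ∀ n p → fromℕ (p ^ n) * 1/! p ≡ W n p 1/!
power-expansion zero    p = trans (*-identityˡ (1/! p)) (sym (W-last p 1/!))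
power-expansion (suc n) p = begin
  fromℕ (p ℕ.* p ^ n) * 1/! p             ≡⟨ cong (_* 1/! p) (fromℕ-* p (p ^ n)) ⟩
  fromℕ p * fromℕ (p ^ n) * 1/! p         ≡⟨ *-assoc (fromℕ p) (fromℕ (p ^ n)) (1/! p) ⟩
  fromℕ p * (fromℕ (p ^ n) * 1/! p)       ≡⟨ cong (fromℕ p *_) (power-expansion n p) ⟩
  fromℕ p * W n p 1/!                     ≡⟨ W-· n p (fromℕ p) 1/! ⟨
  W n p (fromℕ p · 1/!)                   ≡⟨ W-cong n p weight ⟩
  W n p (λ j → (fromℕ p - fromℕ j) * 1/! j + shift 1/! j) ≡⟨ W-suc n p 1/! ⟨
  W (suc n) p 1/!                         ∎
  where
  simplify : ∀ p x → p * x ≡ (p - 0ℚ) * x + 0ℚ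
  simplify = solve-∀ ℚ-ring
  absorb : ∀ p j x → p * x ≡ (p - j) * x + j * x
  absorb = solve-∀ ℚ-ring
  weight : ∀ j → fromℕ p * 1/! j ≡ (fromℕ p - fromℕ j) * 1/! j + shift 1/! j
  weight zero    = simplify (fromℕ p) (1/! 0)
  weight (suc j) = trans (absorb (fromℕ p) (fromℕ (suc j)) (1/! (suc j)))
    (cong ((fromℕ p - fromℕ (suc j)) * 1/! (suc j) +_) (1/!-suc j))

H-suc : ∀ n → H (suc n) ≡ H n + pos 1 / suc n
H-suc n = ∑<-last n (λ i → pos 1 / suc i)

H/! : ℕ → ℚ
H/! j = H j /! j

-- Harmonic weights miss being such an eigenvector by -1/j!, because Hⱼ - Hⱼ₋₁ = 1/j. At j = 0 there
-- is no defect, which the summand `1ₛ` restores.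
H/!-weight : ∀ p j → (fromℕ p - fromℕ j) * H/! j + shift H/! j
                     ≡ fromℕ p * H/! j + (- 1ℚ * 1/! j + 1ₛ j)
H/!-weight p zero    = simplify (fromℕ p)
  where
  simplify : ∀ p → (p - 0ℚ) * 0ℚ + 0ℚ ≡ p * 0ℚ + (- 1ℚ * 1ℚ + 1ℚ)
  simplify = solve-∀ ℚ-ring
H/!-weight p (suc j) = begin
  (fromℕ p - s) * (H (suc j) * i) + H j * 1/! j
    ≡⟨ cong₂ (λ x y → (fromℕ p - s) * (x * i) + H j * y) (H-suc j) (sym (1/!-suc j)) ⟩
  (fromℕ p - s) * ((H j + r) * i) + H j * (s * i)
    ≡⟨ expand (fromℕ p) s (H j) r i ⟩
  fromℕ p * ((H j + r) * i) + (- 1ℚ * (r * s * i) + 0ℚ)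
    ≡⟨ cong₂ (λ x y → fromℕ p * (x * i) + (- 1ℚ * (y * i) + 0ℚ)) (H-suc j) (sym (/-*-fromℕ 1 (suc j))) ⟨
  fromℕ p * (H (suc j) * i) + (- 1ℚ * (1ℚ * i) + 0ℚ)
    ≡⟨ cong (λ x → fromℕ p * (H (suc j) * i) + (- 1ℚ * x + 0ℚ)) (*-identityˡ i) ⟩
  fromℕ p * (H (suc j) * i) + (- 1ℚ * i + 0ℚ) ∎
  where
  s = fromℕ (suc j)
  i = 1/! (suc j)
  r = pos 1 / suc j
  expand : ∀ p s h r i → (p - s) * ((h + r) * i) + h * (s * i)
                          ≡ p * ((h + r) * i) + (- 1ℚ * (r * s * i) + 0ℚ)
  expand = solve-∀ ℚ-ring

W-H/!-suc : ∀ n p → W (suc n) p H/! ≡ fromℕ p * W n p H/! + (- 1ℚ * (fromℕ (p ^ n) * 1/! p) + S p n)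
W-H/!-suc n p = begin
  W (suc n) p H/!
    ≡⟨ W-suc n p H/! ⟩
  W n p (λ j → (fromℕ p - fromℕ j) * H/! j + shift H/! j)
    ≡⟨ W-cong n p (H/!-weight p) ⟩
  W n p (fromℕ p · H/! ⊕ (- 1ℚ · 1/! ⊕ 1ₛ))
    ≡⟨ W-⊕ n p (fromℕ p · H/!) (- 1ℚ · 1/! ⊕ 1ₛ) ⟩
  W n p (fromℕ p · H/!) + W n p (- 1ℚ · 1/! ⊕ 1ₛ)
    ≡⟨ cong₂ _+_ (W-· n p (fromℕ p) H/!) (W-⊕ n p (- 1ℚ · 1/!) 1ₛ) ⟩
  fromℕ p * W n p H/! + (W n p (- 1ℚ · 1/!) + W n p 1ₛ)
    ≡⟨ cong₂ (λ x y → fromℕ p * W n p H/! + (x + y))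
         (trans (W-· n p (- 1ℚ) 1/!) (cong (- 1ℚ *_) (sym (power-expansion n p)))) (W-head n p) ⟩
  fromℕ p * W n p H/! + (- 1ℚ * (fromℕ (p ^ n) * 1/! p) + S p n) ∎

-- The series is (t - H_p) eᵖᵗ / p! plus the harmonic sum. The derivative of t contributes eᵖᵗ / p!,
-- which cancels the defect of the harmonic weights, and their correction at j = 0 supplies the
-- inhomogeneous term `S p`. Keeping n pⁿ⁻¹ and pⁿ H_p apart makes the formula valid from n = 0 on.
R-closed : ∀ p n → R p n ≡ (fromℕ n * fromℕ (p ^ (n ∸ 1)) - fromℕ (p ^ n) * H p) * 1/! p + W n p H/!
R-closed p zero    = begin
  -- The initial condition fixes the constant -H_p: it cancels the only surviving summand H_p / p!
  -- of `W`.
  0ℚ                                                    ≡⟨ simplify (fromℕ (p ^ 0)) (H p) (1/! p) ⟩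
  (0ℚ * fromℕ (p ^ 0) - 1ℚ * H p) * 1/! p + H/! p       ≡⟨ cong ((0ℚ * fromℕ (p ^ 0) - 1ℚ * H p) * 1/! p +_) (W-last p H/!) ⟨
  (0ℚ * fromℕ (p ^ 0) - 1ℚ * H p) * 1/! p + W 0 p H/!   ∎
  where
  simplify : ∀ q h i → 0ℚ ≡ (0ℚ * q - 1ℚ * h) * i + h * i
  simplify = solve-∀ ℚ-ring
R-closed p (suc n) = begin
  q * R p n + S p n
    ≡⟨ cong (λ x → q * x + S p n) (R-closed p n) ⟩
  q * ((fromℕ n * fromℕ (p ^ (n ∸ 1)) - x * H p) * i + w) + S p n
    ≡⟨ expand q (fromℕ n) (fromℕ (p ^ (n ∸ 1))) x (H p) i w (S p n) ⟩
  (fromℕ n * (q * fromℕ (p ^ (n ∸ 1))) - q * x * H p) * i + (q * w + S p n)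
    ≡⟨ cong (λ y → (y - q * x * H p) * i + (q * w + S p n)) (lower n) ⟩
  (fromℕ n * x - q * x * H p) * i + (q * w + S p n)
    ≡⟨ rearrange q (fromℕ n) x (H p) i w (S p n) ⟩
  ((1ℚ + fromℕ n) * x - q * x * H p) * i + (q * w + (- 1ℚ * (x * i) + S p n))
    ≡⟨ cong₂ (λ y z → (y * x - z * H p) * i + (q * w + (- 1ℚ * (x * i) + S p n)))
         (fromℕ-suc n) (fromℕ-* p (p ^ n)) ⟨
  (fromℕ (suc n) * x - fromℕ (p ^ suc n) * H p) * i + (q * w + (- 1ℚ * (x * i) + S p n))
    ≡⟨ cong ((fromℕ (suc n) * x - fromℕ (p ^ suc n) * H p) * i +_) (W-H/!-suc n p) ⟨
  (fromℕ (suc n) * x - fromℕ (p ^ suc n) * H p) * i + W (suc n) p H/! ∎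
  where
  q = fromℕ p
  x = fromℕ (p ^ n)
  i = 1/! p
  w = W n p H/!
  expand : ∀ q n y x h i w s → q * ((n * y - x * h) * i + w) + s ≡ (n * (q * y) - q * x * h) * i + (q * w + s)
  expand = solve-∀ ℚ-ring
  rearrange : ∀ q n x h i w s →
    (n * x - q * x * h) * i + (q * w + s) ≡ ((1ℚ + n) * x - q * x * h) * i + (q * w + (- 1ℚ * (x * i) + s))
  rearrange = solve-∀ ℚ-ring
  -- At n = 0 the truncated exponent makes the two powers differ, but the factor n is 0.
  lower : ∀ n → fromℕ n * (q * fromℕ (p ^ (n ∸ 1))) ≡ fromℕ n * fromℕ (p ^ n)
  lower zero    = trans (*-zeroˡ (q * fromℕ (p ^ 0))) (sym (*-zeroˡ (fromℕ (p ^ 0))))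
  lower (suc n) = cong (fromℕ (suc n) *_) (sym (fromℕ-* p (p ^ n)))

theorem3 : ∀ (n p : ℕ) → p < n →
    (∑[ k ∈ suc p ⋯ n ] fromℕ (n C k) * stirling₂ k (suc p) * B (n ∸ k) p)
    ≡ (fromℕ (p ^ (n ∸ 1)) * (fromℕ n - fromℕ p * H p)) /! p
    + (∑[ j ∈ 1 ⋯ p ] stirling₂ n (p ∸ j) * (H j /! j))
theorem3 n@(suc m) p p<n = begin
  ∑< (n ∸ p) (term ∘ (suc p ℕ.+_))
    ≡⟨ +-identityˡ _ ⟨
  0ℚ + ∑< (n ∸ p) (term ∘ (suc p ℕ.+_))
    -- The sum is extended down to k = 0: the Stirling numbers vanish for k at most p.
    ≡⟨ cong (_+ ∑< (n ∸ p) (term ∘ (suc p ℕ.+_))) (∑<-zero (suc p) term≡0) ⟨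
  ∑< (suc p) term + ∑< (n ∸ p) (term ∘ (suc p ℕ.+_))
    ≡⟨ ∑<-split (suc p) (n ∸ p) term ⟨
  ∑< (suc (p ℕ.+ (n ∸ p))) term
    ≡⟨ cong (λ k → ∑< (suc k) term) (ℕ.m+[n∸m]≡n (ℕ.<⇒≤ p<n)) ⟩
  ∑< (suc n) term
    ≡⟨ ∑-binomial-∗ (S (suc p)) (λ k → B k p) n ⟩
  G p n
    ≡⟨ G≗R p n ⟩
  R p n
    ≡⟨ R-closed p n ⟩
  (fromℕ n * x - fromℕ (p ^ n) * H p) * 1/! p + W n p H/!
    ≡⟨ cong (λ y → (fromℕ n * x - y * H p) * 1/! p + W n p H/!) (fromℕ-* p (p ^ m)) ⟩
  (fromℕ n * x - fromℕ p * x * H p) * 1/! p + (S p n * H/! 0 + tail)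
    -- The summand j = 0 of `W` carries H₀ = 0, which leaves the sum from j = 1.
    ≡⟨ rearrange (fromℕ n) (fromℕ p) x (H p) (1/! p) (S p n) tail ⟩
  x * (fromℕ n - fromℕ p * H p) * 1/! p + tail ∎
  where
  x = fromℕ (p ^ m)
  term : ℕ → ℚ
  term k = fromℕ (n C k) * stirling₂ k (suc p) * B (n ∸ k) p
  tail = ∑< p (λ j → stirling₂ n (p ∸ suc j) * H/! (suc j))
  vanish : ∀ c b → c * 0ℚ * b ≡ 0ℚ
  vanish = solve-∀ ℚ-ring
  term≡0 : ∀ k → k < suc p → term k ≡ 0ℚ
  term≡0 k k<1+p = trans (cong (λ s → fromℕ (n C k) * s * B (n ∸ k) p) (S-vanishes (suc p) k k<1+p))
                         (vanish (fromℕ (n C k)) (B (n ∸ k) p))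
  rearrange : ∀ n p x h i s t → (n * x - p * x * h) * i + (s * 0ℚ + t) ≡ x * (n - p * h) * i + t
  rearrange = solve-∀ ℚ-ring
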